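{- Let $p$ be a prime and let $n \geq 4$ be an integer. If $p$ is odd, then $f(n) \leq 3$. If $p = 2$, then $f(n) \leq 4$.
   Context: $\mathbb{Z}_p$ is the ring of $p$-adic integers and $M_n(\mathbb{Z}_p)$ is the ring of $n \times n$ matrices over $\mathbb{Z}_p$. A form $\sum_{i=1}^m a_i X_i^2$ with $a_i \in \mathbb{Z}_p$ is universal over $M_n(\mathbb{Z}_p)$ if for every $A \in M_n(\mathbb{Z}_p)$ there exist $X_1, \ldots, X_m \in M_n(\mathbb{Z}_p)$ with $A = \sum_{i=1}^m a_i X_i^2$. For a fixed prime $p$ and an integer $n \geq 3$, $f(n)$ is the smallest integer $m \geq 3$ such that for all $p$-adic integers $a_1, a_2, \ldots, a_m$ with at least three of them (counted by index) units, the form $\sum_{i=1}^m a_i X_i^2$ is universal over $M_n(\mathbb{Z}_p)$. -}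

module Defs where

open import Algebra.Bundles using (CommutativeRing)
open import Data.Fin.Base using (Fin)
open import Data.Integer.Base as ℤ using (ℤ; +_; 0ℤ; 1ℤ)
open import Data.Integer.Divisibility.Signed
  using (_∣_; divides; ∣m∣n⇒∣m+n; ∣m⇒∣-m; ∣n⇒∣m*n)
import Data.Integer.Properties as ℤ
open import Data.Integer.Tactic.RingSolver using (solve-∀)
open import Data.Nat.Base using (ℕ; suc; _≤_)
open import Data.Product.Base using (Σ-syntax; ∃-syntax; _×_; _,_)
open import Data.Vec.Functional using (Vector)
open import Function.Bundles using (_↣_; module Injection)
open import Level using (Level; 0ℓ; _⊔_)
open import Relation.Binary.PropositionalEquality
  using (_≡_; refl; subst)

infix 4 _≡_[mod_]

record _≡_[mod_] (x y m : ℤ) : Set where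
  constructor mk-mod
  field
    divides-difference : m ∣ x ℤ.- y

module _ {m : ℤ} where

  mod-reflexive : ∀ {x y} → x ≡ y → x ≡ y [mod m ]
  mod-reflexive {x} refl = mk-mod (divides 0ℤ (ℤ.+-inverseʳ x))

  mod-sym : ∀ {x y} → x ≡ y [mod m ] → y ≡ x [mod m ]
  mod-sym {x} {y} (mk-mod h) = mk-mod (subst (m ∣_) (identity x y) (∣m⇒∣-m h))
    where
    identity : ∀ x y → ℤ.- (x ℤ.- y) ≡ y ℤ.- x
    identity = solve-∀

  mod-trans : ∀ {x y z} → x ≡ y [mod m ] → y ≡ z [mod m ] → x ≡ z [mod m ]
  mod-trans {x} {y} {z} (mk-mod h) (mk-mod h′) = mk-mod
    (subst (m ∣_) (identity x y z) (∣m∣n⇒∣m+n h h′))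
    where
    identity : ∀ x y z → (x ℤ.- y) ℤ.+ (y ℤ.- z) ≡ x ℤ.- z
    identity = solve-∀

  mod-+ : ∀ {x y u v} → x ≡ y [mod m ] → u ≡ v [mod m ] →
          x ℤ.+ u ≡ y ℤ.+ v [mod m ]
  mod-+ {x} {y} {u} {v} (mk-mod h) (mk-mod h′) = mk-mod
    (subst (m ∣_) (identity x y u v) (∣m∣n⇒∣m+n h h′))
    where
    identity : ∀ x y u v →
               (x ℤ.- y) ℤ.+ (u ℤ.- v) ≡ (x ℤ.+ u) ℤ.- (y ℤ.+ v)
    identity = solve-∀

  mod-* : ∀ {x y u v} → x ≡ y [mod m ] → u ≡ v [mod m ] →
          x ℤ.* u ≡ y ℤ.* v [mod m ]
  mod-* {x} {y} {u} {v} (mk-mod h) (mk-mod h′) = mk-mod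
    (subst (m ∣_) (identity x y u v) (∣m∣n⇒∣m+n (∣n⇒∣m*n u h) (∣n⇒∣m*n y h′)))
    where
    identity : ∀ x y u v →
               u ℤ.* (x ℤ.- y) ℤ.+ y ℤ.* (u ℤ.- v) ≡ x ℤ.* u ℤ.- y ℤ.* v
    identity = solve-∀

  mod-neg : ∀ {x y} → x ≡ y [mod m ] → ℤ.- x ≡ ℤ.- y [mod m ]
  mod-neg {x} {y} (mk-mod h) = mk-mod (subst (m ∣_) (identity x y) (∣m⇒∣-m h))
    where
    identity : ∀ x y → ℤ.- (x ℤ.- y) ≡ (ℤ.- x) ℤ.- (ℤ.- y)
    identity = solve-∀

-- ℤₚ is the inverse limit of the rings ℤ/pᵏ: the k-th approximation is an
-- integer representing the component in ℤ/pᵏ, so two elements are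
-- identified when their k-th approximations agree modulo pᵏ for every k.

record PAdicInt (p : ℕ) : Set where
  field
    approx   : ℕ → ℤ
    coherent : ∀ k → approx (suc k) ≡ approx k [mod (+ p) ℤ.^ k ]

open PAdicInt public

module _ (p : ℕ) where

  infix 4 _≈ₚ_

  record _≈ₚ_ (x y : PAdicInt p) : Set where
    constructor mk≈ₚ
    field
      agree : ∀ k → approx x k ≡ approx y k [mod (+ p) ℤ.^ k ]

  open _≈ₚ_ public

  private
    pointwise : ∀ {x y : PAdicInt p} →
                (∀ k → approx x k ≡ approx y k) → x ≈ₚ y
    pointwise h = mk≈ₚ λ k → mod-reflexive (h k)

  constantₚ : ℤ → PAdicInt p
  constantₚ z = record
    { approx   = λ _ → z
    ; coherent = λ _ → mod-reflexive refl
    }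

  _+ₚ_ : PAdicInt p → PAdicInt p → PAdicInt p
  x +ₚ y = record
    { approx   = λ k → approx x k ℤ.+ approx y k
    ; coherent = λ k → mod-+ (coherent x k) (coherent y k)
    }

  _*ₚ_ : PAdicInt p → PAdicInt p → PAdicInt p
  x *ₚ y = record
    { approx   = λ k → approx x k ℤ.* approx y k
    ; coherent = λ k → mod-* (coherent x k) (coherent y k)
    }

  -ₚ_ : PAdicInt p → PAdicInt p
  -ₚ x = record
    { approx   = λ k → ℤ.- approx x k
    ; coherent = λ k → mod-neg (coherent x k)
    }

  ℤₚ : CommutativeRing 0ℓ 0ℓ
  ℤₚ = record
    { Carrier = PAdicInt p
    ; _≈_     = _≈ₚ_
    ; _+_     = _+ₚ_
    ; _*_     = _*ₚ_
    ; -_      = -ₚ_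
    ; 0#      = constantₚ 0ℤ
    ; 1#      = constantₚ 1ℤ
    ; isCommutativeRing = record
      { isRing = record
        { +-isAbelianGroup = record
          { isGroup = record
            { isMonoid = record
              { isSemigroup = record
                { isMagma = record
                  { isEquivalence = record
                    { refl  = pointwise λ _ → refl
                    ; sym   = λ h → mk≈ₚ λ k → mod-sym (agree h k)
                    ; trans = λ h h′ → mk≈ₚ λ k →
                                mod-trans (agree h k) (agree h′ k)
                    }
                  ; ∙-cong = λ h h′ → mk≈ₚ λ k → mod-+ (agree h k) (agree h′ k)
                  }
                ; assoc = λ x y z → pointwise λ k →
                            ℤ.+-assoc (approx x k) (approx y k) (approx z k)
                }
              ; identity = (λ x → pointwise λ k → ℤ.+-identityˡ (approx x k))
                         , (λ x → pointwise λ k → ℤ.+-identityʳ (approx x k))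
              }
            ; inverse = (λ x → pointwise λ k → ℤ.+-inverseˡ (approx x k))
                      , (λ x → pointwise λ k → ℤ.+-inverseʳ (approx x k))
            ; ⁻¹-cong = λ h → mk≈ₚ λ k → mod-neg (agree h k)
            }
          ; comm = λ x y → pointwise λ k → ℤ.+-comm (approx x k) (approx y k)
          }
        ; *-cong = λ h h′ → mk≈ₚ λ k → mod-* (agree h k) (agree h′ k)
        ; *-assoc = λ x y z → pointwise λ k →
                      ℤ.*-assoc (approx x k) (approx y k) (approx z k)
        ; *-identity = (λ x → pointwise λ k → ℤ.*-identityˡ (approx x k))
                     , (λ x → pointwise λ k → ℤ.*-identityʳ (approx x k))
        ; distrib = (λ x y z → pointwise λ k →
                       ℤ.*-distribˡ-+ (approx x k) (approx y k) (approx z k))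
                  , (λ x y z → pointwise λ k →
                       ℤ.*-distribʳ-+ (approx x k) (approx y k) (approx z k))
        }
      ; *-comm = λ x y → pointwise λ k → ℤ.*-comm (approx x k) (approx y k)
      }
    }

module DiagonalForms {c ℓ : Level} (R : CommutativeRing c ℓ) where

  open CommutativeRing R
  open import Algebra.Definitions _≈_ using (Invertible)
  open import Algebra.Properties.Monoid.Sum +-monoid using (sum-syntax)

  Unit : Carrier → Set (c ⊔ ℓ)
  Unit = Invertible 1# _*_

  Matrix : ℕ → Set c
  Matrix n = Vector (Vector Carrier n) n

  infix  4 _≈ᴹ_
  infixl 7 _*ᴹ_

  _≈ᴹ_ : ∀ {n} → Matrix n → Matrix n → Set ℓ
  A ≈ᴹ B = ∀ r s → A r s ≈ B r s

  _*ᴹ_ : ∀ {n} → Matrix n → Matrix n → Matrix n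
  _*ᴹ_ {n} A B r s = ∑[ t < n ] (A r t * B t s)

  diagonalForm : ∀ {m n} → Vector Carrier m → Vector (Matrix n) m → Matrix n
  diagonalForm {m} a X r s = ∑[ i < m ] (a i * (X i *ᴹ X i) r s)

  Universal : ∀ {m} → ℕ → Vector Carrier m → Set (c ⊔ ℓ)
  Universal {m} n a =
    (A : Matrix n) → ∃[ X ] A ≈ᴹ diagonalForm {m} {n} a X

  -- Three distinct indices, so repeated values count separately.
  AtLeastThreeUnits : ∀ {m} → Vector Carrier m → Set (c ⊔ ℓ)
  AtLeastThreeUnits {m} a =
    Σ[ ι ∈ (Fin 3 ↣ Fin m) ] (∀ j → Unit (a (Injection.to ι j)))

IsLeast : ∀ {ℓ} → (ℕ → Set ℓ) → ℕ → Set ℓ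
IsLeast P m = P m × (∀ k → P k → m ≤ k)

Admissible : ℕ → ℕ → ℕ → Set
Admissible p n m =
  3 ≤ m × ((a : Vector Carrier m) → AtLeastThreeUnits a → Universal n a)
  where
  open CommutativeRing (ℤₚ p) using (Carrier)
  open DiagonalForms (ℤₚ p)

infix 4 f[_,_]≡_ f[_,_]≤_

-- f(n) for the prime p is given by its graph, so that f[ p , n ]≤ b includes
-- the assertion that the minimum exists.
f[_,_]≡_ : ℕ → ℕ → ℕ → Set
f[ p , n ]≡ m = IsLeast (Admissible p n) m

f[_,_]≤_ : ℕ → ℕ → ℕ → Set
f[ p , n ]≤ b = ∃[ m ] (f[ p , n ]≡ m × m ≤ b)

{-# OPTIONS --safe #-}

-- For p = 2 as well as for odd p, already three unit coefficients a, b, d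
-- suffice. Split A into 2 × 2 blocks. The squares of [0 W; 0 T] and [0 0; V S]
-- with T, S invertible have arbitrary off-diagonal blocks and lower right
-- blocks T², S². Taking the third matrix as [P 1; R P+E], one can choose R to
-- match the upper left block of A, and it remains to solve
--   a T² + b S² + d (E P + P E + E²) = B
-- with B arbitrary (for odd n there is one more row, but also more freedom).
-- When E is the shift, E P + P E matches everything but one row, and that row
-- is supplied by T or, for odd n, by the extra row of the third matrix. For
-- even n, E is the shift bordered by a diagonal entry 1, whose border costs
-- only the parity of one entry. In both cases what is left is one scalar
-- equation modulo 2, solvable because x² + x is always even in ℤₚ.
module Submission where

open import Defs
open import Data.Nat.Base using (ℕ; _≤_)
open import Data.Nat.Divisibility using (_∣_)
open import Data.Nat.Primality using (Prime)
open import Data.Product.Base using (_×_)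
open import Relation.Binary.PropositionalEquality using (_≡_)
open import Relation.Nullary using (¬_)

open import Algebra.Bundles using (CommutativeRing; RawRing)
import Algebra.Properties.AbelianGroup
import Algebra.Properties.CommutativeSemigroup
import Algebra.Properties.Ring
import Algebra.Properties.Semiring.Mult
import Algebra.Properties.Semiring.Sum
import Algebra.Solver.Ring
open import Algebra.Solver.Ring.AlmostCommutativeRing
  using (_-Raw-AlmostCommutative⟶_; fromCommutativeRing)
open import Data.Fin.Base using (Fin; zero; suc; _↑ˡ_; _↑ʳ_; splitAt; join; punchOut)
open import Data.Fin.Patterns using (0F; 1F; 2F)
open import Data.Fin.Properties as Fin
  using (any?; injective⇒≤; punchOut-injective; splitAt-↑ˡ; splitAt-↑ʳ; join-splitAt)
open import Data.Integer.Base as ℤ using (ℤ; +_; 0ℤ; 1ℤ)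
import Data.Integer.DivMod as ℤ
import Data.Integer.Divisibility.Signed as ℤ
import Data.Integer.Properties as ℤ
open import Data.Integer.Tactic.RingSolver using (solve-∀)
open import Data.Maybe.Base using (Maybe; just; nothing)
open import Data.Nat.Base as ℕ using (zero; suc; z≤n; s≤s)
open import Data.Nat.DivMod using (_%_; _/_; m%n<n; m≡m%n+[m/n]*n)
open import Data.Nat.Divisibility using (m%n≡0⇒n∣m)
import Data.Nat.Properties as ℕ
open import Data.Product.Base using (Σ-syntax; ∃-syntax; _,_; proj₁; proj₂)
open import Data.Sum.Base using (_⊎_; inj₁; inj₂)
open import Data.Vec.Functional using (Vector; []; _∷_)
open import Function.Base using (_∘_)
open import Function.Bundles using (module Injection)
open import Function.Definitions using (Injective)
open import Level using (Level; 0ℓ)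
import Relation.Binary.PropositionalEquality as ≡
import Relation.Binary.Reasoning.Setoid
open import Relation.Nullary using (yes; no; contradiction)

-- A ring solver with integer coefficients over an arbitrary commutative ring.

module IntegralSolver {c ℓ : Level} (R : CommutativeRing c ℓ) where

  open CommutativeRing R
  open Algebra.Properties.AbelianGroup +-abelianGroup using (⁻¹-∙-comm; ⁻¹-anti-homo‿-; ε⁻¹≈ε)
  open Algebra.Properties.Ring ring using (x[y-z]≈xy-xz; [y-z]x≈yx-zx)
  open Algebra.Properties.Semiring.Mult semiring renaming (_×_ to _·_)
  open Relation.Binary.Reasoning.Setoid setoid
  open Algebra.Properties.CommutativeSemigroup +-commutativeSemigroup
    using (interchange)

  -- The pair (m , n) stands for the integer m − n.
  Differences : RawRing 0ℓ 0ℓ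
  Differences = record
    { Carrier = ℕ × ℕ
    ; _≈_     = _≡_
    ; _+_     = λ (m , n) (k , l) → m ℕ.+ k , n ℕ.+ l
    ; _*_     = λ (m , n) (k , l) → m ℕ.* k ℕ.+ n ℕ.* l , m ℕ.* l ℕ.+ n ℕ.* k
    ; -_      = λ (m , n) → n , m
    ; 0#      = 0 , 0
    ; 1#      = 1 , 0
    }

  private
    module D = RawRing Differences

    ⟦_⟧ : ℕ × ℕ → Carrier
    ⟦ m , n ⟧ = m · 1# - n · 1#

    x-0≈x : ∀ x → x - 0# ≈ x
    x-0≈x x = trans (+-congˡ ε⁻¹≈ε) (+-identityʳ x)

    [x+y]-[z+w] : ∀ x y z w → (x + y) - (z + w) ≈ (x - z) + (y - w)
    [x+y]-[z+w] x y z w = begin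
      (x + y) - (z + w)     ≈⟨ +-congˡ (⁻¹-∙-comm z w) ⟨
      (x + y) + (- z - w)   ≈⟨ interchange x y (- z) (- w) ⟩
      (x - z) + (y - w)     ∎

    ⟦⟧-+ : ∀ x y → ⟦ x D.+ y ⟧ ≈ ⟦ x ⟧ + ⟦ y ⟧
    ⟦⟧-+ (m , n) (k , l) = begin
      (m ℕ.+ k) · 1# - (n ℕ.+ l) · 1#       ≈⟨ +-cong (×-homo-+ 1# m k) (-‿cong (×-homo-+ 1# n l)) ⟩
      (m · 1# + k · 1#) - (n · 1# + l · 1#) ≈⟨ [x+y]-[z+w] _ _ _ _ ⟩
      (m · 1# - n · 1#) + (k · 1# - l · 1#) ∎

    products : ∀ m n k l →
               (m ℕ.* k ℕ.+ n ℕ.* l) · 1# ≈ (m · 1#) * (k · 1#) + (n · 1#) * (l · 1#)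
    products m n k l =
      trans (×-homo-+ 1# (m ℕ.* k) (n ℕ.* l)) (+-cong (×1-homo-* m k) (×1-homo-* n l))

    ⟦⟧-* : ∀ x y → ⟦ x D.* y ⟧ ≈ ⟦ x ⟧ * ⟦ y ⟧
    ⟦⟧-* (m , n) (k , l) = begin
      ⟦ m ℕ.* k ℕ.+ n ℕ.* l , m ℕ.* l ℕ.+ n ℕ.* k ⟧ ≈⟨ +-cong (products m n k l) (-‿cong (products m n l k)) ⟩
      (x * z + y * w) - (x * w + y * z)   ≈⟨ [x+y]-[z+w] _ _ _ _ ⟩
      (x * z - x * w) + (y * w - y * z)   ≈⟨ +-congˡ (⁻¹-anti-homo‿- _ _) ⟨
      (x * z - x * w) - (y * z - y * w)   ≈⟨ +-cong (x[y-z]≈xy-xz x z w) (-‿cong (x[y-z]≈xy-xz y z w)) ⟨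
      x * (z - w) - y * (z - w)           ≈⟨ [y-z]x≈yx-zx (z - w) x y ⟨
      (x - y) * (z - w)                   ∎
      where
      x = m · 1#
      y = n · 1#
      z = k · 1#
      w = l · 1#

    -- Pairs that stand for the same integer must get the same value. Padding with `w - w` on one
    -- side and removing `y - y` on the other turns the cross sum into an equality of differences.
    ⟦⟧-cong : ∀ m n k l → m ℕ.+ l ≡ k ℕ.+ n → ⟦ m , n ⟧ ≈ ⟦ k , l ⟧
    ⟦⟧-cong m n k l eq = begin
      x - y             ≈⟨ +-identityʳ _ ⟨
      (x - y) + 0#      ≈⟨ +-congˡ (-‿inverseʳ w) ⟨
      (x - y) + (w - w) ≈⟨ [x+y]-[z+w] x w y w ⟨
      (x + w) - (y + w) ≈⟨ +-cong x+w≈z+y (-‿cong (+-comm y w)) ⟩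
      (z + y) - (w + y) ≈⟨ [x+y]-[z+w] z y w y ⟩
      (z - w) + (y - y) ≈⟨ +-congˡ (-‿inverseʳ y) ⟩
      (z - w) + 0#      ≈⟨ +-identityʳ _ ⟩
      z - w             ∎
      where
      x = m · 1#
      y = n · 1#
      z = k · 1#
      w = l · 1#
      x+w≈z+y : x + w ≈ z + y
      x+w≈z+y = begin
        x + w            ≈⟨ ×-homo-+ 1# m l ⟨
        (m ℕ.+ l) · 1#   ≡⟨ ≡.cong (_· 1#) eq ⟩
        (k ℕ.+ n) · 1#   ≈⟨ ×-homo-+ 1# k n ⟩
        z + y            ∎

    -- Unlike ⟦_⟧, this depends definitionally only on the integer m − n, and
    -- sends 0 and 1 definitionally to 0# and 1#; the solver needs both.
    ⟦_⟧′ : ℕ × ℕ → Carrier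
    ⟦ suc m , suc n ⟧′ = ⟦ m , n ⟧′
    ⟦ 0 , 0 ⟧′         = 0#
    ⟦ 1 , 0 ⟧′         = 1#
    ⟦ x ⟧′             = ⟦ x ⟧

    ⟦⟧′≈⟦⟧ : ∀ x → ⟦ x ⟧′ ≈ ⟦ x ⟧
    ⟦⟧′≈⟦⟧ (0 , 0)           = sym (x-0≈x 0#)
    ⟦⟧′≈⟦⟧ (1 , 0)           = sym (trans (x-0≈x (1 · 1#)) (+-identityʳ 1#))
    ⟦⟧′≈⟦⟧ (suc (suc m) , 0) = refl
    ⟦⟧′≈⟦⟧ (0 , suc n)       = refl
    ⟦⟧′≈⟦⟧ (suc m , suc n)   = trans (⟦⟧′≈⟦⟧ (m , n)) (⟦⟧-cong m n (suc m) (suc n) (ℕ.+-suc m n))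

    morphism : Differences -Raw-AlmostCommutative⟶ fromCommutativeRing R
    morphism = record
      { ⟦_⟧    = ⟦_⟧′
      ; +-homo = λ x y → trans (⟦⟧′≈⟦⟧ (x D.+ y)) (trans (⟦⟧-+ x y)
                   (sym (+-cong (⟦⟧′≈⟦⟧ x) (⟦⟧′≈⟦⟧ y))))
      ; *-homo = λ x y → trans (⟦⟧′≈⟦⟧ (x D.* y)) (trans (⟦⟧-* x y)
                   (sym (*-cong (⟦⟧′≈⟦⟧ x) (⟦⟧′≈⟦⟧ y))))
      ; -‿homo = λ x@(m , n) → trans (⟦⟧′≈⟦⟧ (n , m)) (sym (trans (-‿cong (⟦⟧′≈⟦⟧ x))
                   (⁻¹-anti-homo‿- (m · 1#) (n · 1#))))
      ; 0-homo = refl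
      ; 1-homo = refl
      }

    -- Coefficients are compared as integers, by cross sums, so like terms cancel even where
    -- equality in `R` is undecidable.
    _≟_ : ∀ x y → Maybe (⟦ x ⟧′ ≈ ⟦ y ⟧′)
    (m , n) ≟ (k , l) with m ℕ.+ l ℕ.≟ k ℕ.+ n
    ... | yes eq = just (trans (⟦⟧′≈⟦⟧ (m , n)) (trans (⟦⟧-cong m n k l eq) (sym (⟦⟧′≈⟦⟧ (k , l)))))
    ... | no  _  = nothing

  open Algebra.Solver.Ring Differences (fromCommutativeRing R) morphism _≟_ public
    using (Polynomial; con; solve; _:=_; _:+_; _:*_; _:-_; :-_)

  ⟨0⟩ ⟨1⟩ : ∀ {n} → Polynomial n
  ⟨0⟩ = con (0 , 0)
  ⟨1⟩ = con (1 , 0)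

-- Pigeonhole and the choice of block sizes.

-- Punching out a missed value would inject `Fin (suc n)` into `Fin n`.
injective⇒surjective : ∀ {n} {f : Fin n → Fin n} → Injective _≡_ _≡_ f → ∀ i → ∃[ j ] f j ≡ i
injective⇒surjective {suc n} {f} f-injective i with any? (λ j → f j Fin.≟ i)
... | yes hit = hit
... | no miss = contradiction
  (injective⇒≤ {f = λ j → punchOut (avoids j)}
    (λ {j} {k} eq → f-injective (punchOut-injective (avoids j) (avoids k) eq)))
  ℕ.1+n≰n
  where
  avoids : ∀ j → ¬ i ≡ f j
  avoids j i≡fj = miss (j , ≡.sym i≡fj)

-- The summands are the sizes of the two diagonal blocks; for odd `n` the lower block is the larger
-- by one.
halves : ∀ n → 3 ≤ n →
  (∃[ m ] n ≡ suc m ℕ.+ suc (suc m)) ⊎ (∃[ m ] n ≡ suc (suc m) ℕ.+ suc (suc m))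
halves 1 (s≤s ())
halves 2 (s≤s (s≤s ()))
halves 3 _ = inj₁ (0 , ≡.refl)
halves (suc (suc (suc (suc k)))) _ with halves (suc (suc (suc k))) (s≤s (s≤s (s≤s z≤n)))
... | inj₁ (m , eq) = inj₂ (m , ≡.cong suc eq)
... | inj₂ (m , eq) = inj₁ (suc m , ≡.trans (≡.cong suc eq) (≡.sym (ℕ.+-suc (suc (suc m)) (suc (suc m)))))

-- Algebra of rectangular matrices.

module MatrixForms {c ℓ : Level} (R : CommutativeRing c ℓ) where

  open CommutativeRing R hiding (zero)
  open Algebra.Properties.Semiring.Sum semiring
    using (sum; sum-cong-≋; sum-replicate-zero; ∑-distrib-+; ∑-comm; *-distribˡ-sum; *-distribʳ-sum)
  open DiagonalForms R
  open IntegralSolver R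
  open Relation.Binary.Reasoning.Setoid setoid

  private
    variable
      k l m n : ℕ

  Mat : ℕ → ℕ → Set c
  Mat m n = Fin m → Fin n → Carrier

  infix  4 _≋_
  infixl 7 _⊗_

  _≋_ : Mat m n → Mat m n → Set ℓ
  A ≋ B = ∀ i j → A i j ≈ B i j

  _⊗_ : Mat m n → Mat n k → Mat m k
  (A ⊗ B) i j = sum (λ t → A i t * B t j)

  𝟎 : Mat m n
  𝟎 _ _ = 0#

  𝟏 : Mat n n
  𝟏 zero    zero    = 1#
  𝟏 zero    (suc j) = 0#
  𝟏 (suc i) zero    = 0#
  𝟏 (suc i) (suc j) = 𝟏 i j

  sum-zero : {f : Vector Carrier n} → (∀ i → f i ≈ 0#) → sum f ≈ 0#
  sum-zero {n} h = trans (sum-cong-≋ h) (sum-replicate-zero n)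

  sum-distrib : ∀ (f g h : Vector Carrier n) → (∀ t → f t ≈ g t + h t) → sum f ≈ sum g + sum h
  sum-distrib f g h eq = trans (sum-cong-≋ eq) (∑-distrib-+ g h)

  ⊗-cong : {A A′ : Mat m n} {B B′ : Mat n k} → A ≋ A′ → B ≋ B′ → A ⊗ B ≋ A′ ⊗ B′
  ⊗-cong p q i j = sum-cong-≋ λ t → *-cong (p i t) (q t j)

  𝟎-⊗ : (B : Mat n k) → 𝟎 {m} ⊗ B ≋ 𝟎
  𝟎-⊗ B i j = sum-zero λ t → zeroˡ (B t j)

  ⊗-𝟎 : (A : Mat m n) → A ⊗ 𝟎 {n} {k} ≋ 𝟎
  ⊗-𝟎 A i j = sum-zero λ t → zeroʳ (A i t)

  𝟏-⊗ : (B : Mat n k) → 𝟏 ⊗ B ≋ B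
  𝟏-⊗ B zero    j = trans (+-cong (*-identityˡ _) (sum-zero λ t → zeroˡ (B (suc t) j)))
                      (+-identityʳ _)
  𝟏-⊗ B (suc i) j = trans (+-cong (zeroˡ _) (𝟏-⊗ (B ∘ suc) i j)) (+-identityˡ _)

  ⊗-𝟏 : (A : Mat m n) → A ⊗ 𝟏 ≋ A
  ⊗-𝟏 A i zero    = trans (+-cong (*-identityʳ _) (sum-zero λ t → zeroʳ (A i (suc t))))
                      (+-identityʳ _)
  ⊗-𝟏 A i (suc j) = trans (+-cong (zeroʳ _) (⊗-𝟏 (λ i t → A i (suc t)) i j)) (+-identityˡ _)

  ⊗-assoc : (A : Mat m n) (B : Mat n k) (C : Mat k l) → (A ⊗ B) ⊗ C ≋ A ⊗ (B ⊗ C)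
  ⊗-assoc A B C i j = begin
    sum (λ u → sum (λ t → A i t * B t u) * C u j)
      ≈⟨ sum-cong-≋ (λ u → *-distribʳ-sum (C u j) (λ t → A i t * B t u)) ⟩
    sum (λ u → sum (λ t → A i t * B t u * C u j))
      ≈⟨ ∑-comm (λ u t → A i t * B t u * C u j) ⟩
    sum (λ t → sum (λ u → A i t * B t u * C u j))
      ≈⟨ sum-cong-≋ (λ t → sum-cong-≋ λ u → *-assoc (A i t) (B t u) (C u j)) ⟩
    sum (λ t → sum (λ u → A i t * (B t u * C u j)))
      ≈⟨ sum-cong-≋ (λ t → *-distribˡ-sum (A i t) (λ u → B t u * C u j)) ⟨
    sum (λ t → A i t * sum (λ u → B t u * C u j)) ∎

  -- Block matrices and the reduction to the diagonal blocks.

  sum-splits : (f : Vector Carrier (m ℕ.+ n)) →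
               sum f ≈ sum (λ i → f (i ↑ˡ n)) + sum (λ j → f (m ↑ʳ j))
  sum-splits {zero}  f = sym (+-identityˡ _)
  sum-splits {suc m} f = trans (+-congˡ (sum-splits {m} (f ∘ suc))) (sym (+-assoc _ _ _))

  module _ (P : Mat m m) (Q : Mat m n) (R : Mat n m) (S : Mat n n) where

    private
      entry : Fin m ⊎ Fin n → Fin m ⊎ Fin n → Carrier
      entry (inj₁ i) (inj₁ j) = P i j
      entry (inj₁ i) (inj₂ j) = Q i j
      entry (inj₂ i) (inj₁ j) = R i j
      entry (inj₂ i) (inj₂ j) = S i j

    blocks : Mat (m ℕ.+ n) (m ℕ.+ n)
    blocks r s = entry (splitAt m r) (splitAt m s)

    private
      blocks₁₁ : ∀ i j → blocks (i ↑ˡ n) (j ↑ˡ n) ≡ P i j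
      blocks₁₁ i j = ≡.cong₂ entry (splitAt-↑ˡ m i n) (splitAt-↑ˡ m j n)

      blocks₁₂ : ∀ i j → blocks (i ↑ˡ n) (m ↑ʳ j) ≡ Q i j
      blocks₁₂ i j = ≡.cong₂ entry (splitAt-↑ˡ m i n) (splitAt-↑ʳ m n j)

      blocks₂₁ : ∀ i j → blocks (m ↑ʳ i) (j ↑ˡ n) ≡ R i j
      blocks₂₁ i j = ≡.cong₂ entry (splitAt-↑ʳ m n i) (splitAt-↑ˡ m j n)

      blocks₂₂ : ∀ i j → blocks (m ↑ʳ i) (m ↑ʳ j) ≡ S i j
      blocks₂₂ i j = ≡.cong₂ entry (splitAt-↑ʳ m n i) (splitAt-↑ʳ m n j)

      two-sums : ∀ r s {f f′ : Vector Carrier m} {g g′ : Vector Carrier n} →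
        (∀ t → blocks r (t ↑ˡ n) ≡ f t) → (∀ t → blocks (t ↑ˡ n) s ≡ f′ t) →
        (∀ t → blocks r (m ↑ʳ t) ≡ g t) → (∀ t → blocks (m ↑ʳ t) s ≡ g′ t) →
        (blocks ⊗ blocks) r s ≈ sum (λ t → f t * f′ t) + sum (λ t → g t * g′ t)
      two-sums r s p p′ q q′ = trans (sum-splits {m} _) (+-cong
        (sum-cong-≋ λ t → reflexive (≡.cong₂ _*_ (p t) (p′ t)))
        (sum-cong-≋ λ t → reflexive (≡.cong₂ _*_ (q t) (q′ t))))

    square₁₁ : ∀ i j → (blocks ⊗ blocks) (i ↑ˡ n) (j ↑ˡ n) ≈ (P ⊗ P) i j + (Q ⊗ R) i j
    square₁₁ i j = two-sums _ _ (blocks₁₁ i) (λ t → blocks₁₁ t j) (blocks₁₂ i) (λ t → blocks₂₁ t j)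

    square₁₂ : ∀ i j → (blocks ⊗ blocks) (i ↑ˡ n) (m ↑ʳ j) ≈ (P ⊗ Q) i j + (Q ⊗ S) i j
    square₁₂ i j = two-sums _ _ (blocks₁₁ i) (λ t → blocks₁₂ t j) (blocks₁₂ i) (λ t → blocks₂₂ t j)

    square₂₁ : ∀ i j → (blocks ⊗ blocks) (m ↑ʳ i) (j ↑ˡ n) ≈ (R ⊗ P) i j + (S ⊗ R) i j
    square₂₁ i j = two-sums _ _ (blocks₂₁ i) (λ t → blocks₁₁ t j) (blocks₂₂ i) (λ t → blocks₂₁ t j)

    square₂₂ : ∀ i j → (blocks ⊗ blocks) (m ↑ʳ i) (m ↑ʳ j) ≈ (R ⊗ Q) i j + (S ⊗ S) i j
    square₂₂ i j = two-sums _ _ (blocks₂₁ i) (λ t → blocks₁₂ t j) (blocks₂₂ i) (λ t → blocks₂₂ t j)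

  -- Every index is the `join` of its `splitAt`, so a property of all entries can be checked block
  -- by block.
  by-quadrants : ∀ m {n p} (F : Fin (m ℕ.+ n) → Fin (m ℕ.+ n) → Set p) →
    (∀ i j → F (i ↑ˡ n) (j ↑ˡ n)) → (∀ i j → F (i ↑ˡ n) (m ↑ʳ j)) →
    (∀ i j → F (m ↑ʳ i) (j ↑ˡ n)) → (∀ i j → F (m ↑ʳ i) (m ↑ʳ j)) → ∀ r s → F r s
  by-quadrants m {n} F F₁₁ F₁₂ F₂₁ F₂₂ r s =
    ≡.subst₂ F (join-splitAt m n r) (join-splitAt m n s) (quadrant (splitAt m r) (splitAt m s))
    where
    quadrant : ∀ x y → F (join m n x) (join m n y)
    quadrant (inj₁ i) (inj₁ j) = F₁₁ i j
    quadrant (inj₁ i) (inj₂ j) = F₁₂ i j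
    quadrant (inj₂ i) (inj₁ j) = F₂₁ i j
    quadrant (inj₂ i) (inj₂ j) = F₂₂ i j

  unit-cancel : ∀ {u} ((u⁻¹ , _) : Unit u) x → u * (u⁻¹ * x) ≈ x
  unit-cancel (u⁻¹ , _ , uu⁻¹≈1) x =
    trans (sym (*-assoc _ _ _)) (trans (*-congʳ uu⁻¹≈1) (*-identityˡ x))

  -- The upper right block of the first square is `C ⊗ T⁻¹ ⊗ T`, hence `C`, and its lower left block
  -- is zero; the second square has zero and `S ⊗ (S⁻¹ ⊗ D)`, hence `D`, in these places. Thus `C`
  -- and `D` absorb whatever the third square leaves off the diagonal, and only the two equations
  -- for the diagonal blocks remain.
  block-representation : ∀ {m n} (α : Vector Carrier 3) → (∀ i → Unit (α i)) →
    (A : Mat (m ℕ.+ n) (m ℕ.+ n))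
    (T T⁻¹ S S⁻¹ : Mat n n) → T⁻¹ ⊗ T ≋ 𝟏 → S ⊗ S⁻¹ ≋ 𝟏 →
    (P : Mat m m) (Q : Mat m n) (Q′ : Mat n m) (P′ : Mat n n) →
    (∀ i j → α 2F * ((P ⊗ P) i j + (Q ⊗ Q′) i j) ≈ A (i ↑ˡ n) (j ↑ˡ n)) →
    (∀ i j → α 0F * (T ⊗ T) i j + (α 1F * (S ⊗ S) i j
               + α 2F * ((Q′ ⊗ Q) i j + (P′ ⊗ P′) i j)) ≈ A (m ↑ʳ i) (m ↑ʳ j)) →
    ∃[ X ] A ≈ᴹ diagonalForm α X
  block-representation {m} {n} α units A T T⁻¹ S S⁻¹ T⁻¹T≋𝟏 SS⁻¹≋𝟏 P Q Q′ P′ h₁₁ h₂₂ =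
    X ∷ Y ∷ Z ∷ [] , by-quadrants m _ c₁₁ c₁₂ c₂₁ c₂₂
    where
    a = α 0F
    b = α 1F
    d = α 2F

    -- `C` and `D` are the off-diagonal blocks of `A` less those of the third square, divided by the
    -- units `a` and `b`.
    C : Mat m n
    C i j = proj₁ (units 0F) * (A (i ↑ˡ n) (m ↑ʳ j) - d * ((P ⊗ Q) i j + (Q ⊗ P′) i j))

    D : Mat n m
    D i j = proj₁ (units 1F) * (A (m ↑ʳ i) (j ↑ˡ n) - d * ((Q′ ⊗ P) i j + (P′ ⊗ Q′) i j))

    X = blocks 𝟎 (C ⊗ T⁻¹) 𝟎 T
    Y = blocks 𝟎 𝟎 (S⁻¹ ⊗ D) S
    Z = blocks P Q Q′ P′

    combine : ∀ {x x′ y y′ z z′ w} → x ≈ x′ → y ≈ y′ → z ≈ z′ →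
      a * x′ + (b * y′ + d * z′) ≈ w → w ≈ a * x + (b * y + (d * z + 0#))
    combine x≈ y≈ z≈ eq = sym (trans (+-cong (*-congˡ x≈) (+-cong (*-congˡ y≈)
      (trans (+-identityʳ _) (*-congˡ z≈)))) eq)

    zeros : ∀ {m n k m′ n′ k′} (B : Mat n k) (B′ : Mat m′ n′) i j i′ j′ →
      (𝟎 {m} ⊗ B) i j + (B′ ⊗ 𝟎 {n′} {k′}) i′ j′ ≈ 0#
    zeros B B′ i j i′ j′ = trans (+-cong (𝟎-⊗ B i j) (⊗-𝟎 B′ i′ j′)) (+-identityʳ 0#)

    C-recovered : ∀ i j → (C ⊗ T⁻¹ ⊗ T) i j ≈ C i j
    C-recovered i j = trans (⊗-assoc C T⁻¹ T i j)
      (trans (⊗-cong {A = C} (λ _ _ → refl) T⁻¹T≋𝟏 i j) (⊗-𝟏 C i j))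

    D-recovered : ∀ i j → (S ⊗ (S⁻¹ ⊗ D)) i j ≈ D i j
    D-recovered i j = trans (sym (⊗-assoc S S⁻¹ D i j))
      (trans (⊗-cong {B = D} SS⁻¹≋𝟏 (λ _ _ → refl) i j) (𝟏-⊗ D i j))

    c₁₁ : ∀ i j → _
    c₁₁ i j = combine
      (trans (square₁₁ 𝟎 (C ⊗ T⁻¹) 𝟎 T i j) (zeros (𝟎 {m} {m}) (C ⊗ T⁻¹) i j i j))
      (trans (square₁₁ 𝟎 𝟎 (S⁻¹ ⊗ D) S i j)
        (trans (+-cong (𝟎-⊗ (𝟎 {m} {m}) i j) (𝟎-⊗ (S⁻¹ ⊗ D) i j)) (+-identityʳ 0#)))
      (square₁₁ P Q Q′ P′ i j)
      (trans (solve 3 (λ a b x → a :* ⟨0⟩ :+ (b :* ⟨0⟩ :+ x) := x) refl a b _) (h₁₁ i j))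

    c₁₂ : ∀ i j → _
    c₁₂ i j = combine
      (trans (square₁₂ 𝟎 (C ⊗ T⁻¹) 𝟎 T i j)
        (trans (+-cong (𝟎-⊗ (C ⊗ T⁻¹) i j) (C-recovered i j)) (+-identityˡ _)))
      (trans (square₁₂ 𝟎 𝟎 (S⁻¹ ⊗ D) S i j)
        (trans (+-cong (𝟎-⊗ (𝟎 {m} {n}) i j) (𝟎-⊗ S i j)) (+-identityʳ 0#)))
      (square₁₂ P Q Q′ P′ i j)
      (trans (+-congʳ (unit-cancel (units 0F) _))
        (solve 3 (λ b x y → (x :- y) :+ (b :* ⟨0⟩ :+ y) := x) refl b _ _))

    c₂₁ : ∀ i j → _
    c₂₁ i j = combine
      (trans (square₂₁ 𝟎 (C ⊗ T⁻¹) 𝟎 T i j) (zeros (𝟎 {m} {m}) T i j i j))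
      (trans (square₂₁ 𝟎 𝟎 (S⁻¹ ⊗ D) S i j)
        (trans (+-cong (⊗-𝟎 (S⁻¹ ⊗ D) i j) (D-recovered i j)) (+-identityˡ _)))
      (square₂₁ P Q Q′ P′ i j)
      (trans (+-congˡ (+-congʳ (unit-cancel (units 1F) _)))
        (solve 3 (λ a x y → a :* ⟨0⟩ :+ ((x :- y) :+ y) := x) refl a _ _))

    c₂₂ : ∀ i j → _
    c₂₂ i j = combine
      (trans (square₂₂ 𝟎 (C ⊗ T⁻¹) 𝟎 T i j)
        (trans (+-congʳ (𝟎-⊗ (C ⊗ T⁻¹) i j)) (+-identityˡ _)))
      (trans (square₂₂ 𝟎 𝟎 (S⁻¹ ⊗ D) S i j)
        (trans (+-congʳ (⊗-𝟎 (S⁻¹ ⊗ D) i j)) (+-identityˡ _)))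
      (square₂₂ P Q Q′ P′ i j)
      (h₂₂ i j)

  -- The shift and linear equations with it.

  e : Fin n → Carrier
  e zero    = 1#
  e (suc i) = 0#

  -- Ones on the subdiagonal. Deleting the first row and column leaves the smaller shift, which
  -- drives the recursions below.
  shift : Mat n n
  shift zero    _       = 0#
  shift (suc i) zero    = e i
  shift (suc i) (suc j) = shift i j

  𝟏-first : ∀ i → 𝟏 {suc n} i zero ≡ e i
  𝟏-first zero    = ≡.refl
  𝟏-first (suc i) = ≡.refl

  sum-e : (f : Vector Carrier (suc n)) (x : Carrier) → sum (λ t → f t * (e t * x)) ≈ f zero * x
  sum-e f x = trans (+-cong (*-congˡ (*-identityˡ x))
      (sum-zero λ t → trans (*-congˡ (zeroˡ x)) (zeroʳ (f (suc t)))))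
    (+-identityʳ _)

  sum-e₁ : (f : Vector Carrier (suc n)) → sum (λ t → f t * e t) ≈ f zero
  sum-e₁ f = trans (+-cong (*-identityʳ _) (sum-zero λ t → zeroʳ (f (suc t)))) (+-identityʳ _)

  -- `𝟏` plus the shift is lower unitriangular: forward substitution, where the first unknown feeds
  -- only the next equation. This and the row version determine the border of `P̂` in the even case.
  solve-𝟏+shift-column : (y : Vector Carrier n) →
    Σ[ x ∈ Vector Carrier n ] (∀ i → x i + sum (λ t → shift i t * x t) ≈ y i)
  solve-𝟏+shift-column {zero}  y = (λ ()) , λ ()
  solve-𝟏+shift-column {suc n} y = x , eq
    where
    rest = solve-𝟏+shift-column λ i → y (suc i) - e i * y zero
    x : Vector Carrier (suc n)
    x zero    = y zero
    x (suc i) = proj₁ rest i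
    eq : ∀ i → x i + sum (λ t → shift i t * x t) ≈ y i
    eq zero    = trans (+-congˡ (sum-zero λ t → zeroˡ (x t))) (+-identityʳ _)
    eq (suc i) = trans
      (solve 3 (λ x z w → x :+ (z :+ w) := (x :+ w) :+ z) refl (x (suc i)) _ _)
      (trans (+-congʳ (proj₂ rest i))
        (solve 2 (λ y z → (y :- z) :+ z := y) refl (y (suc i)) _))

  -- Substitution runs backwards here: equation `j` reads `x j + x (j + 1) = y j`, so the tail is
  -- solved before the first entry.
  solve-𝟏+shift-row : (y : Vector Carrier n) →
    Σ[ x ∈ Vector Carrier n ] (∀ j → x j + sum (λ t → x t * shift t j) ≈ y j)
  solve-𝟏+shift-row {zero}  y = (λ ()) , λ ()
  solve-𝟏+shift-row {suc n} y = x , eq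
    where
    rest = solve-𝟏+shift-row (y ∘ suc)
    x : Vector Carrier (suc n)
    x zero    = y zero - sum (λ t → proj₁ rest t * e t)
    x (suc j) = proj₁ rest j
    eq : ∀ j → x j + sum (λ t → x t * shift t j) ≈ y j
    eq zero    = solve 2 (λ y s → (y :- s) :+ ((y :- s) :* ⟨0⟩ :+ s) := y) refl (y zero) _
    eq (suc j) = trans
      (+-congˡ (trans (+-congʳ (zeroʳ (x zero))) (+-identityˡ _))) (proj₂ rest j)

  -- The rank one term with ρ is the obstruction to solving LP + PL = B for
  -- the shift L; that it does not depend on the prescribed first column v
  -- allows v to be chosen after ρ.
  solve-anticommutator : (B : Mat n n) → Σ[ ρ ∈ Vector Carrier n ] (∀ (v : Vector Carrier n) → Σ[ P ∈ Mat n n ]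
    (∀ i j → ((shift ⊗ P) i j + (P ⊗ shift) i j) + e i * ρ j ≈ B i j) ×
    (∀ i → sum (λ t → P i t * e t) ≈ v i))
  solve-anticommutator {zero}  B = (λ ()) , λ v → (λ ()) , (λ ()) , λ ()
  solve-anticommutator {suc n} B = ρ , λ v → P v , eq v , λ i → sum-first v i
    where
    rest = solve-anticommutator λ i j → B (suc i) (suc j)
    ρ′ = proj₁ rest

    -- Row zero of LP vanishes and that of PL involves only the row `ρ′` of `P`, so the defect `ρ`
    -- is known before `v`.
    ρ : Vector Carrier (suc n)
    ρ j = B zero j - sum (λ t → ρ′ t * shift (suc t) j)

    module _ (v : Vector Carrier (suc n)) where
      -- Below its first entry, column zero of the equation sees `P′` only through its first column,
      -- which is prescribed accordingly.
      v′ : Vector Carrier n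
      v′ i = B (suc i) zero - (e i * v zero + sum (λ t → shift i t * v (suc t)))

      P′ = proj₁ (proj₂ rest v′)

      P : Mat (suc n) (suc n)
      P i       zero    = v i
      -- As first row of `P`, `ρ′` contributes `e i * ρ′ j` to LP: exactly the obstruction of the
      -- smaller problem.
      P zero    (suc j) = ρ′ j
      P (suc i) (suc j) = P′ i j

      eq : ∀ i j → ((shift ⊗ P) i j + (P ⊗ shift) i j) + e i * ρ j ≈ B i j
      eq zero j = trans
        (+-congʳ (+-cong (sum-zero λ t → zeroˡ (P t j)) (+-congʳ (zeroʳ (v zero)))))
        (solve 2 (λ b s → (⟨0⟩ :+ (⟨0⟩ :+ s)) :+ ⟨1⟩ :* (b :- s) := b) refl (B zero j) _)
      eq (suc i) zero = trans
        (+-congʳ (+-congˡ (+-congˡ (proj₂ (proj₂ (proj₂ rest v′)) i))))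
        (solve 4 (λ s v b r → (s :+ (v :* ⟨0⟩ :+ (b :- s))) :+ ⟨0⟩ :* r := b) refl
          _ (v (suc i)) (B (suc i) zero) (ρ zero))
      eq (suc i) (suc j) = trans
        (solve 5 (λ er s v s′ r → ((er :+ s) :+ (v :* ⟨0⟩ :+ s′)) :+ ⟨0⟩ :* r := (s :+ s′) :+ er)
          refl _ _ (v (suc i)) _ (ρ (suc j)))
        (proj₁ (proj₂ (proj₂ rest v′)) i j)

      sum-first : ∀ i → sum (λ t → P i t * e t) ≈ v i
      sum-first i = sum-e₁ (P i)

  -- Bordered matrices and two families of invertible matrices.

  border : Carrier → Vector Carrier n → Vector Carrier n → Mat n n → Mat (suc n) (suc n)
  border α t s M zero    zero    = α
  border α t s M zero    (suc j) = t j
  border α t s M (suc i) zero    = s i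
  border α t s M (suc i) (suc j) = M i j

  -- The matrices that agree with the identity below the first two rows: `α` and `t` form the first
  -- row, `ε` and `κ` the deviation in the second.
  Φ : Carrier → Vector Carrier n → Carrier → Vector Carrier n → Mat (suc n) (suc n)
  Φ α t ε κ = border α t (λ i → e i * ε) (λ i j → 𝟏 i j + e i * κ j)

  -- The family is closed under multiplication, so squares and inverses within it reduce to
  -- identities between the parameters.
  Φ-⊗ : ∀ α t ε κ α′ t′ ε′ κ′ → Φ {suc n} α t ε κ ⊗ Φ α′ t′ ε′ κ′ ≋
    Φ (α * α′ + t zero * ε′)
      (λ j → α * t′ j + (t j + t zero * κ′ j))
      (ε * α′ + (ε′ + κ zero * ε′))
      (λ j → ε * t′ j + (κ j + (κ′ j + κ zero * κ′ j)))
  Φ-⊗ {n} α t ε κ α′ t′ ε′ κ′ = eq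
    where
    sum-𝟏+eκ : ∀ f j → sum {suc n} (λ u → f u * (𝟏 u j + e u * κ′ j)) ≈ f j + f zero * κ′ j
    sum-𝟏+eκ f j = trans
      (sum-distrib _ (λ u → f u * 𝟏 u j) (λ u → f u * (e u * κ′ j)) (λ u → distribˡ (f u) _ _))
      (+-cong (⊗-𝟏 {m = 1} (λ _ → f) zero j) (sum-e f (κ′ j)))

    eq : Φ α t ε κ ⊗ Φ α′ t′ ε′ κ′ ≋ Φ _ _ _ _
    eq zero zero       = +-congˡ (sum-e t ε′)
    eq zero (suc j)    = +-congˡ (sum-𝟏+eκ t j)
    eq (suc i) zero    = trans
      (+-congˡ (trans (sum-e (λ u → 𝟏 i u + e i * κ u) ε′)
                 (*-congʳ (+-congʳ (reflexive (𝟏-first i))))))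
      (solve 5 (λ e ε α′ κ₀ ε′ → e :* ε :* α′ :+ (e :+ e :* κ₀) :* ε′
                  := e :* (ε :* α′ :+ (ε′ :+ κ₀ :* ε′))) refl
        (e i) ε α′ (κ zero) ε′)
    eq (suc i) (suc j) = trans
      (+-congˡ (trans (sum-𝟏+eκ (λ u → 𝟏 i u + e i * κ u) j)
                 (+-congˡ (*-congʳ (+-congʳ (reflexive (𝟏-first i)))))))
      (solve 7 (λ e ε t′ δ κ κ₀ κ′ → e :* ε :* t′ :+ ((δ :+ e :* κ) :+ (e :+ e :* κ₀) :* κ′)
                  := δ :+ e :* (ε :* t′ :+ (κ :+ (κ′ :+ κ₀ :* κ′)))) refl
        (e i) ε (t′ j) (𝟏 i j) (κ j) (κ zero) (κ′ j))

  Φ-𝟏 : ∀ {α} {t : Vector Carrier n} {ε κ} → α ≈ 1# → (∀ j → t j ≈ 0#) → ε ≈ 0# →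
        (∀ j → κ j ≈ 0#) → Φ α t ε κ ≋ 𝟏
  Φ-𝟏 α≈ t≈ ε≈ κ≈ zero    zero    = α≈
  Φ-𝟏 α≈ t≈ ε≈ κ≈ zero    (suc j) = t≈ j
  Φ-𝟏 α≈ t≈ ε≈ κ≈ (suc i) zero    = trans (*-congˡ ε≈) (zeroʳ _)
  Φ-𝟏 α≈ t≈ ε≈ κ≈ (suc i) (suc j) =
    trans (+-congˡ (trans (*-congˡ (κ≈ j)) (zeroʳ _))) (+-identityʳ _)

  ≋-trans : {A B C : Mat m n} → A ≋ B → B ≋ C → A ≋ C
  ≋-trans p q i j = trans (p i j) (q i j)

  module Shear (t : Vector Carrier (suc n)) where

    -- In block form `T` is the product of the shears [1 t; 0 1] and [1 0; e 1], hence invertible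
    -- for every `t`. The inner block of its square is the identity plus `e i * t j`, so it provides
    -- an arbitrary row where the anticommutator has its obstruction.
    T T⁻¹ : Mat (suc (suc n)) (suc (suc n))
    T   = Φ (1# + t zero) t 1# (λ _ → 0#)
    T⁻¹ = Φ 1# (λ j → - t j) (- 1#) t

    T⁻¹⊗T : T⁻¹ ⊗ T ≋ 𝟏
    T⁻¹⊗T = ≋-trans (Φ-⊗ 1# (λ j → - t j) (- 1#) t (1# + t zero) t 1# (λ _ → 0#)) (Φ-𝟏
      (solve 1 (λ t₀ → ⟨1⟩ :* (⟨1⟩ :+ t₀) :+ (:- t₀) :* ⟨1⟩ := ⟨1⟩) refl (t zero))
      (λ j → solve 2 (λ t t₀ → ⟨1⟩ :* t :+ (:- t :+ (:- t₀) :* ⟨0⟩) := ⟨0⟩) refl (t j) (t zero))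
      (solve 1 (λ t₀ → (:- ⟨1⟩) :* (⟨1⟩ :+ t₀) :+ (⟨1⟩ :+ t₀ :* ⟨1⟩) := ⟨0⟩) refl (t zero))
      (λ j → solve 2 (λ t t₀ → (:- ⟨1⟩) :* t :+ (t :+ (⟨0⟩ :+ t₀ :* ⟨0⟩)) := ⟨0⟩) refl
               (t j) (t zero)))

    private
      T² = Φ-⊗ (1# + t zero) t 1# (λ _ → 0#) (1# + t zero) t 1# (λ _ → 0#)

    T²-corner : (T ⊗ T) zero zero ≈ (1# + t zero) * (1# + t zero) + t zero
    T²-corner = trans (T² zero zero) (+-congˡ (*-identityʳ _))

    T²-inner : ∀ i j → (T ⊗ T) (suc i) (suc j) ≈ 𝟏 i j + e i * t j
    T²-inner i j = trans (T² (suc i) (suc j)) (+-congˡ (*-congˡ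
      (solve 1 (λ t → ⟨1⟩ :* t :+ (⟨0⟩ :+ (⟨0⟩ :+ ⟨0⟩ :* ⟨0⟩)) := t) refl (t j))))

  -- On the first two coordinates S has trace 1 and determinant −1, so that
  -- S² = S + 1 is linear in x there.
  module Golden {n : ℕ} (x : Carrier) where

    z = (1# + x) - x * x

    S S⁻¹ : Mat (suc (suc n)) (suc (suc n))
    S   = Φ (1# - x) (λ j → z * e j) 1# (λ j → (x - 1#) * e j)
    -- From S² = S + 1 follows S (S - 1) = 1; so the inverse is S - 1 on the first two coordinates.
    S⁻¹ = Φ (- x) (λ j → z * e j) 1# (λ j → ((x - 1#) - 1#) * e j)

    S⊗S⁻¹ : S ⊗ S⁻¹ ≋ 𝟏
    S⊗S⁻¹ = ≋-trans
      (Φ-⊗ (1# - x) (λ j → z * e j) 1# (λ j → (x - 1#) * e j)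
           (- x) (λ j → z * e j) 1# (λ j → ((x - 1#) - 1#) * e j))
      (Φ-𝟏
      (solve 1 (λ x → (⟨1⟩ :- x) :* (:- x) :+ ((⟨1⟩ :+ x) :- x :* x) :* ⟨1⟩ :* ⟨1⟩ := ⟨1⟩) refl x)
      (λ j → solve 2 (λ x e → let z = (⟨1⟩ :+ x) :- x :* x in
               (⟨1⟩ :- x) :* (z :* e) :+ (z :* e :+ z :* ⟨1⟩ :* (((x :- ⟨1⟩) :- ⟨1⟩) :* e)) := ⟨0⟩)
               refl x (e j))
      (solve 1 (λ x → ⟨1⟩ :* (:- x) :+ (⟨1⟩ :+ (x :- ⟨1⟩) :* ⟨1⟩ :* ⟨1⟩) := ⟨0⟩) refl x)
      (λ j → solve 2 (λ x e → let z = (⟨1⟩ :+ x) :- x :* x in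
               ⟨1⟩ :* (z :* e) :+ ((x :- ⟨1⟩) :* e :+ (((x :- ⟨1⟩) :- ⟨1⟩) :* e
                 :+ (x :- ⟨1⟩) :* ⟨1⟩ :* (((x :- ⟨1⟩) :- ⟨1⟩) :* e))) := ⟨0⟩)
               refl x (e j)))

    private
      S² = Φ-⊗ (1# - x) (λ (j : Fin (suc n)) → z * e j) 1# (λ j → (x - 1#) * e j)
               (1# - x) (λ j → z * e j) 1# (λ j → (x - 1#) * e j)

    S²-corner : (S ⊗ S) zero zero ≈ (1# + 1#) - x
    S²-corner = trans (S² zero zero)
      (solve 1 (λ x → (⟨1⟩ :- x) :* (⟨1⟩ :- x) :+ ((⟨1⟩ :+ x) :- x :* x) :* ⟨1⟩ :* ⟨1⟩
                  := (⟨1⟩ :+ ⟨1⟩) :- x) refl x)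

    S²-column : ∀ i → (S ⊗ S) (suc i) zero ≈ e i
    S²-column i = trans (S² (suc i) zero)
      (solve 2 (λ e x → e :* (⟨1⟩ :* (⟨1⟩ :- x) :+ (⟨1⟩ :+ (x :- ⟨1⟩) :* ⟨1⟩ :* ⟨1⟩)) := e)
        refl (e i) x)

    S²-inner : ∀ i j → (S ⊗ S) (suc i) (suc j) ≈ 𝟏 i j + e i * (x * e j)
    S²-inner i j = trans (S² (suc i) (suc j)) (+-congˡ (*-congˡ
      (solve 2 (λ x e → ⟨1⟩ :* (((⟨1⟩ :+ x) :- x :* x) :* e) :+ ((x :- ⟨1⟩) :* e
                 :+ ((x :- ⟨1⟩) :* e :+ (x :- ⟨1⟩) :* ⟨1⟩ :* ((x :- ⟨1⟩) :* e))) := x :* e)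
        refl x (e j))))

  -- Representation by three unit coefficients, for odd and for even size.

  ⊗-square-+ : (P L : Mat n n) → ∀ i j →
    sum (λ u → (P i u + L i u) * (P u j + L u j)) ≈
      (P ⊗ P) i j + (((L ⊗ P) i j + (P ⊗ L) i j) + (L ⊗ L) i j)
  ⊗-square-+ P L i j = begin
    sum (λ u → (P i u + L i u) * (P u j + L u j))
      ≈⟨ sum-distrib _ (λ u → P i u * (P u j + L u j)) (λ u → L i u * (P u j + L u j))
           (λ u → distribʳ _ (P i u) (L i u)) ⟩
    sum (λ u → P i u * (P u j + L u j)) + sum (λ u → L i u * (P u j + L u j))
      ≈⟨ +-cong (sum-distrib _ (λ u → P i u * P u j) (λ u → P i u * L u j) (λ u → distribˡ (P i u) _ _))
                (sum-distrib _ (λ u → L i u * P u j) (λ u → L i u * L u j) (λ u → distribˡ (L i u) _ _)) ⟩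
    ((P ⊗ P) i j + (P ⊗ L) i j) + ((L ⊗ P) i j + (L ⊗ L) i j)
      ≈⟨ solve 4 (λ w x y z → (w :+ x) :+ (y :+ z) := w :+ ((y :+ x) :+ z)) refl
           ((P ⊗ P) i j) ((P ⊗ L) i j) ((L ⊗ P) i j) ((L ⊗ L) i j) ⟩
    (P ⊗ P) i j + (((L ⊗ P) i j + (P ⊗ L) i j) + (L ⊗ L) i j) ∎

  module _ (triangular : ∀ x → ∃[ y ] y + y ≈ x + x * x)
           (α : Vector Carrier 3) (units : ∀ i → Unit (α i)) where

    private
      a = α 0F
      b = α 1F
      d = α 2F

      a⁻¹ = proj₁ (units 0F)
      b⁻¹ = proj₁ (units 1F)
      d⁻¹ = proj₁ (units 2F)

      a-cancel = unit-cancel (units 0F)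
      b-cancel = unit-cancel (units 1F)
      d-cancel = unit-cancel (units 2F)

    -- The third matrix has lower right block `P′`, which is `P + shift` bordered by the row `s` and
    -- the column `e`. The inner block of its square gains `e i * s j`, which removes the
    -- obstruction `ρ`; hence `T` can be `𝟏`.
    odd-representation : (A : Mat (suc n ℕ.+ suc (suc n)) (suc n ℕ.+ suc (suc n))) →
                         ∃[ X ] A ≈ᴹ diagonalForm α X
    odd-representation {n} A = block-representation α units A
      𝟏 𝟏 S S⁻¹ (𝟏-⊗ 𝟏) S⊗S⁻¹ P Q Q′ P′ corner₁ corner₂
      where
      A₁ : Mat (suc n) (suc n)
      A₁ i j = A (i ↑ˡ suc (suc n)) (j ↑ˡ suc (suc n))

      A₂ : Mat (suc (suc n)) (suc (suc n))
      A₂ i j = A (suc n ↑ʳ i) (suc n ↑ʳ j)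

      G₁ G₂ : Mat (suc n) (suc n)
      G₁ i j = d⁻¹ * A₁ i j
      G₂ i j = d⁻¹ * (A₂ (suc i) (suc j) - (a * 𝟏 i j + b * 𝟏 i j))

      anticommutator = solve-anticommutator λ i j → (G₂ i j - G₁ i j) - (shift ⊗ shift) i j
      ρ = proj₁ anticommutator

      -- The corner equation has the terms d σ² - d y - b x. Since b x = d y and 2 y = σ + σ², they
      -- collapse to - d σ, and the equation becomes linear in `σ`.
      σ = d⁻¹ * (((a + (b + b)) + d * ρ zero) - A₂ zero zero)
      y = proj₁ (triangular σ)
      x = b⁻¹ * (d * y)
      open Golden {n} x using (S⊗S⁻¹; S²-corner; S²-column; S²-inner; S; S⁻¹)

      -- Below the corner, column zero of the lower block sees `P` only through its first column,
      -- which is chosen here; `ρ`, and with it `σ`, is already fixed.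
      solution = proj₂ anticommutator λ i →
        (d⁻¹ * (A₂ (suc i) zero - b * e i) - e i * σ) - sum (λ u → shift i u * e u)
      P = proj₁ solution

      -- The correction by `y` changes the corner and one inner entry; in the inner entry the term
      -- `x` of the square of `S` compensates it, because b x = d y.
      s : Vector Carrier (suc n)
      s j = ρ j - y * e j

      P′ : Mat (suc (suc n)) (suc (suc n))
      P′ = border σ s e (λ i j → P i j + shift i j)

      -- `Q ⊗ Q′` sees only the rows of `Q′` below the first. They match the upper left block, while
      -- the first row stays free to match row zero of the lower block to the right of its corner.
      Q : Mat (suc n) (suc (suc n))
      Q i zero    = 0#
      Q i (suc j) = 𝟏 i j

      Q′ : Mat (suc (suc n)) (suc n)
      Q′ zero j    = d⁻¹ * (A₂ zero (suc j) - (a * (𝟏 ⊗ 𝟏) zero (suc j) + b * (S ⊗ S) zero (suc j)))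
                     - (P′ ⊗ P′) zero (suc j)
      Q′ (suc i) j = G₁ i j - (P ⊗ P) i j

      Q⊗Q′ : ∀ i j → (Q ⊗ Q′) i j ≈ Q′ (suc i) j
      Q⊗Q′ i j = trans (+-cong (zeroˡ (Q′ zero j)) (𝟏-⊗ (λ u → Q′ (suc u)) i j)) (+-identityˡ _)

      corner₁ : ∀ i j → d * ((P ⊗ P) i j + (Q ⊗ Q′) i j) ≈ A₁ i j
      corner₁ i j = trans
        (*-congˡ (trans (+-congˡ (Q⊗Q′ i j))
          (solve 2 (λ p g → p :+ (g :- p) := g) refl ((P ⊗ P) i j) (G₁ i j))))
        (d-cancel (A₁ i j))

      corner₂ : ∀ i j → a * (𝟏 ⊗ 𝟏) i j + (b * (S ⊗ S) i j
                  + d * ((Q′ ⊗ Q) i j + (P′ ⊗ P′) i j)) ≈ A₂ i j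
      corner₂ zero zero = begin
        a * (𝟏 {suc (suc n)} ⊗ 𝟏) 0F 0F + (b * (S ⊗ S) 0F 0F + d * ((Q′ ⊗ Q) 0F 0F + (P′ ⊗ P′) 0F 0F))
          ≈⟨ +-cong (*-congˡ (𝟏-⊗ (𝟏 {suc (suc n)}) 0F 0F)) (+-cong (*-congˡ S²-corner)
               (*-congˡ (+-cong (⊗-𝟎 Q′ 0F (zero {0})) (+-congˡ (sum-e₁ s))))) ⟩
        a * 1# + (b * ((1# + 1#) - x) + d * (0# + (σ * σ + (ρ zero - y * 1#))))
          ≈⟨ solve 7 (λ a b d x ρ σ y →
               a :* ⟨1⟩ :+ (b :* ((⟨1⟩ :+ ⟨1⟩) :- x) :+ d :* (⟨0⟩ :+ (σ :* σ :+ (ρ :- y :* ⟨1⟩))))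
               := (((a :+ (b :+ b)) :+ d :* ρ) :- d :* σ) :+ ((d :* (σ :+ σ :* σ) :- d :* y) :- b :* x))
               refl a b d x (ρ zero) σ y ⟩
        (((a + (b + b)) + d * ρ zero) - d * σ) + ((d * (σ + σ * σ) - d * y) - b * x)
          ≈⟨ +-cong (+-congˡ (-‿cong (d-cancel _))) (+-cong
               (+-congʳ (*-congˡ (sym (proj₂ (triangular σ))))) (-‿cong (b-cancel (d * y)))) ⟩
        (((a + (b + b)) + d * ρ zero) - (((a + (b + b)) + d * ρ zero) - A₂ zero zero))
          + ((d * (y + y) - d * y) - d * y)
          ≈⟨ solve 4 (λ k w d y → (k :- (k :- w)) :+ ((d :* (y :+ y) :- d :* y) :- d :* y) := w)
               refl ((a + (b + b)) + d * ρ zero) (A₂ zero zero) d y ⟩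
        A₂ zero zero ∎
      corner₂ zero (suc j) = trans
        (+-congˡ (+-congˡ (*-congˡ (trans
          (+-congʳ (⊗-𝟏 Q′ zero j))
          (solve 2 (λ g p → (g :- p) :+ p := g) refl _ ((P′ ⊗ P′) zero (suc j)))))))
        (trans (+-congˡ (+-congˡ (d-cancel _)))
          (solve 3 (λ x y w → x :+ (y :+ (w :- (x :+ y))) := w) refl
            (a * (𝟏 ⊗ 𝟏) zero (suc j)) (b * (S ⊗ S) zero (suc j)) (A₂ zero (suc j))))
      corner₂ (suc i) zero = begin
        a * (𝟏 ⊗ 𝟏) (suc i) 0F + (b * (S ⊗ S) (suc i) 0F
          + d * ((Q′ ⊗ Q) (suc i) 0F + (P′ ⊗ P′) (suc i) 0F))
          ≈⟨ +-cong (*-congˡ (𝟏-⊗ 𝟏 (suc i) 0F)) (+-cong (*-congˡ (S²-column i))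
               (*-congˡ (+-cong (⊗-𝟎 Q′ (suc i) (zero {0})) (+-congˡ (trans
                 (sum-distrib _ (λ u → P i u * e u) (λ u → shift i u * e u)
                   (λ u → distribʳ (e u) (P i u) (shift i u)))
                 (+-congʳ (proj₂ (proj₂ solution) i))))))) ⟩
        a * 0# + (b * e i + d * (0# + (e i * σ + (((g - e i * σ) - λᵢ) + λᵢ))))
          ≈⟨ solve 6 (λ a be d eσ g l →
               a :* ⟨0⟩ :+ (be :+ d :* (⟨0⟩ :+ (eσ :+ (((g :- eσ) :- l) :+ l)))) := be :+ d :* g)
               refl a (b * e i) d (e i * σ) g λᵢ ⟩
        b * e i + d * g
          ≈⟨ +-congˡ (d-cancel _) ⟩
        b * e i + (A₂ (suc i) zero - b * e i)
          ≈⟨ solve 2 (λ x w → x :+ (w :- x) := w) refl (b * e i) (A₂ (suc i) zero) ⟩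
        A₂ (suc i) zero ∎
        where
        g = d⁻¹ * (A₂ (suc i) zero - b * e i)
        λᵢ = sum (λ u → shift i u * e u)
      corner₂ (suc i) (suc j) = begin
        a * (𝟏 ⊗ 𝟏) (suc i) (suc j) + (b * (S ⊗ S) (suc i) (suc j)
          + d * ((Q′ ⊗ Q) (suc i) (suc j) + (P′ ⊗ P′) (suc i) (suc j)))
          ≈⟨ +-cong (*-congˡ (𝟏-⊗ 𝟏 (suc i) (suc j))) (+-cong (*-congˡ (S²-inner i j))
               (*-congˡ (+-cong (⊗-𝟏 Q′ (suc i) j) (+-congˡ (⊗-square-+ P shift i j))))) ⟩
        a * δ + (b * (δ + e i * (x * e j))
          + d * ((G₁ i j - PP) + (e i * (ρ j - y * e j) + (PP + (H + LL)))))
          ≈⟨ +-congˡ (+-congˡ (*-congˡ (solve 8 (λ g p ei ρ y ej h l →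
               (g :- p) :+ (ei :* (ρ :- y :* ej) :+ (p :+ (h :+ l)))
               := ((h :+ ei :* ρ) :+ (g :+ l)) :- ei :* (y :* ej)) refl
               (G₁ i j) PP (e i) (ρ j) y (e j) H LL))) ⟩
        a * δ + (b * (δ + e i * (x * e j))
          + d * (((H + e i * ρ j) + (G₁ i j + LL)) - e i * (y * e j)))
          ≈⟨ +-congˡ (+-congˡ (*-congˡ (+-congʳ (+-congʳ (proj₁ (proj₂ solution) i j))))) ⟩
        a * δ + (b * (δ + e i * (x * e j))
          + d * ((((G₂ i j - G₁ i j) - LL) + (G₁ i j + LL)) - e i * (y * e j)))
          ≈⟨ +-congˡ (+-congˡ (trans
               (*-congˡ (solve 4 (λ g′ g l w → (((g′ :- g) :- l) :+ (g :+ l)) :- w := g′ :- w) refl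
                 (G₂ i j) (G₁ i j) LL (e i * (y * e j))))
               (solve 5 (λ d g ei y ej → d :* (g :- ei :* (y :* ej)) := d :* g :- ei :* (d :* y :* ej))
                 refl d (G₂ i j) (e i) y (e j)))) ⟩
        a * δ + (b * (δ + e i * (x * e j)) + (d * G₂ i j - e i * (d * y * e j)))
          ≈⟨ +-congˡ (+-congˡ (+-cong (d-cancel _)
               (-‿cong (*-congˡ (*-congʳ (sym (b-cancel (d * y)))))))) ⟩
        a * δ + (b * (δ + e i * (x * e j))
          + ((A₂ (suc i) (suc j) - (a * δ + b * δ)) - e i * (b * x * e j)))
          ≈⟨ solve 7 (λ a δ b ei x ej w →
               a :* δ :+ (b :* (δ :+ ei :* (x :* ej)) :+ ((w :- (a :* δ :+ b :* δ)) :- ei :* (b :* x :* ej)))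
               := w) refl a δ b (e i) x (e j) (A₂ (suc i) (suc j)) ⟩
        A₂ (suc i) (suc j) ∎
        where
        δ = 𝟏 i j
        PP = (P ⊗ P) i j
        LL = (shift ⊗ shift) i j
        H = (shift ⊗ P) i j + (P ⊗ shift) i j

    -- The order of choices matters: `ρ` depends on `A` and the coefficients only, then come `x`,
    -- `t`, `y` and `p`. This fixes `T` and `S`, so `rest` is known when the border of `P̂` is
    -- solved for.
    even-representation : (A : Mat (suc (suc n) ℕ.+ suc (suc n)) (suc (suc n) ℕ.+ suc (suc n))) →
                          ∃[ X ] A ≈ᴹ diagonalForm α X
    even-representation {n} A = block-representation α units A
      T T⁻¹ S S⁻¹ T⁻¹⊗T S⊗S⁻¹ P̂ 𝟏 Q′ P′ corner₁ corner₂
      where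
      A₁ A₂ : Mat (suc (suc n)) (suc (suc n))
      A₁ i j = A (i ↑ˡ suc (suc n)) (j ↑ˡ suc (suc n))
      A₂ i j = A (suc (suc n) ↑ʳ i) (suc (suc n) ↑ʳ j)

      G₁ : Mat (suc (suc n)) (suc (suc n))
      G₁ i j = d⁻¹ * A₁ i j

      G₂ : Mat (suc n) (suc n)
      G₂ i j = d⁻¹ * (A₂ (suc i) (suc j) - (a * 𝟏 i j + b * 𝟏 i j))

      anticommutator = solve-anticommutator λ i j →
        (G₂ i j - G₁ (suc i) (suc j)) - (shift ⊗ shift) i j
      ρ = proj₁ anticommutator
      solution = proj₂ anticommutator λ _ → 0#
      P = proj₁ solution

      -- Chosen so that what remains of the corner equation is twice an element.
      x = b⁻¹ * ((a + d) - (A₂ zero zero - A₁ zero zero))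
      open Golden {n} x using (S; S⁻¹; S⊗S⁻¹; S²-corner; S²-inner)

      -- The inner block lacks `d * ρ j` in its first row; `S` already supplies `b * (x * e j)`, and
      -- `T` supplies the difference.
      t : Vector Carrier (suc n)
      t j = a⁻¹ * (d * ρ j - b * (x * e j))
      open Shear t using (T; T⁻¹; T⁻¹⊗T; T²-corner; T²-inner)

      y = proj₁ (triangular (t zero))
      -- After the choice of `x` the corner equation reads 2 (a t₀ + a y + b + d p) = 0, with 2 y
      -- standing for t₀ + t₀².
      p = d⁻¹ * - ((a * t zero + a * y) + b)

      rest : Mat (suc (suc n)) (suc (suc n))
      rest i j = d⁻¹ * (A₂ i j - (a * (T ⊗ T) i j + b * (S ⊗ S) i j)) - G₁ i j

      row    = solve-𝟏+shift-row λ j → rest zero (suc j)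
      column = solve-𝟏+shift-column λ i → rest (suc i) zero

      P̂ Ê P′ Q′ : Mat (suc (suc n)) (suc (suc n))
      P̂ = border p (proj₁ row) (proj₁ column) P
      -- The corner 1 puts `𝟏` plus the shift into the border equations, which makes them solvable;
      -- in the corner of the anticommutator it only gives `p + p`.
      Ê = border 1# (λ _ → 0#) (λ _ → 0#) shift
      P′ i j = P̂ i j + Ê i j
      Q′ i j = G₁ i j - (P̂ ⊗ P̂) i j

      corner₁ : ∀ i j → d * ((P̂ ⊗ P̂) i j + (𝟏 ⊗ Q′) i j) ≈ A₁ i j
      corner₁ i j = trans
        (*-congˡ (trans (+-congˡ (𝟏-⊗ Q′ i j))
          (solve 2 (λ p g → p :+ (g :- p) := g) refl ((P̂ ⊗ P̂) i j) (G₁ i j))))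
        (d-cancel (A₁ i j))

      residue : Mat (suc (suc n)) (suc (suc n))
      residue i j = ((Ê ⊗ P̂) i j + (P̂ ⊗ Ê) i j) + (Ê ⊗ Ê) i j

      residue-00 : residue zero zero ≈ (p + p) + 1#
      residue-00 = trans
        (+-cong (+-cong (+-congˡ (sum-zero λ u → zeroˡ (proj₁ column u)))
                        (+-congˡ (sum-zero λ u → zeroʳ (proj₁ row u))))
                (+-congˡ (sum-zero {suc n} λ u → zeroˡ 0#)))
        (solve 1 (λ p → ((⟨1⟩ :* p :+ ⟨0⟩) :+ (p :* ⟨1⟩ :+ ⟨0⟩)) :+ (⟨1⟩ :* ⟨1⟩ :+ ⟨0⟩)
                  := (p :+ p) :+ ⟨1⟩) refl p)

      residue-0j : ∀ j → residue zero (suc j) ≈ rest zero (suc j)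
      residue-0j j = trans
        (+-cong (+-congʳ (+-congˡ (sum-zero λ u → zeroˡ (P u j))))
                (+-congˡ (sum-zero λ u → zeroˡ (shift u j))))
        (trans (solve 3 (λ p r s → ((⟨1⟩ :* r :+ ⟨0⟩) :+ (p :* ⟨0⟩ :+ s)) :+ (⟨1⟩ :* ⟨0⟩ :+ ⟨0⟩)
                           := r :+ s) refl p (proj₁ row j) _)
          (proj₂ row j))

      residue-i0 : ∀ i → residue (suc i) zero ≈ rest (suc i) zero
      residue-i0 i = trans
        (+-cong (+-congˡ (+-congˡ (sum-zero λ u → zeroʳ (P i u))))
                (+-congˡ (sum-zero λ u → zeroʳ (shift i u))))
        (trans (solve 3 (λ p c s → ((⟨0⟩ :* p :+ s) :+ (c :* ⟨1⟩ :+ ⟨0⟩)) :+ (⟨0⟩ :* ⟨1⟩ :+ ⟨0⟩)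
                           := c :+ s) refl p (proj₁ column i) _)
          (proj₂ column i))

      residue-ij : ∀ i j → residue (suc i) (suc j) ≈
                     ((G₂ i j - G₁ (suc i) (suc j)) - e i * ρ j)
      residue-ij i j = trans
        (solve 6 (λ r c lp pl ll eρ →
           ((⟨0⟩ :* r :+ lp) :+ (c :* ⟨0⟩ :+ pl)) :+ (⟨0⟩ :* ⟨0⟩ :+ ll)
             := ((lp :+ pl) :+ eρ) :+ (ll :- eρ)) refl
           (proj₁ row j) (proj₁ column i) ((shift ⊗ P) i j) ((P ⊗ shift) i j)
           ((shift ⊗ shift) i j) (e i * ρ j))
        (trans (+-congʳ (proj₁ (proj₂ solution) i j))
          (solve 3 (λ g l eρ → (g :- l) :+ (l :- eρ) := g :- eρ) refl
            (G₂ i j - G₁ (suc i) (suc j)) ((shift ⊗ shift) i j) (e i * ρ j)))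

      -- `Q′` was chosen to cancel the square of `P̂`, so the lower block depends linearly on `P̂`.
      reduce : ∀ i j → (Q′ ⊗ 𝟏) i j + (P′ ⊗ P′) i j ≈ G₁ i j + residue i j
      reduce i j = trans (+-cong (⊗-𝟏 Q′ i j) (⊗-square-+ P̂ Ê i j))
        (solve 3 (λ g p r → (g :- p) :+ (p :+ r) := g :+ r) refl
          (G₁ i j) ((P̂ ⊗ P̂) i j) (residue i j))

      fill : ∀ i j → residue i j ≈ rest i j →
        a * (T ⊗ T) i j + (b * (S ⊗ S) i j + d * (G₁ i j + residue i j)) ≈ A₂ i j
      fill i j eq = trans
        (+-congˡ (+-congˡ (trans
          (*-congˡ (trans (+-congˡ eq) (solve 2 (λ g r → g :+ (r :- g) := r) refl (G₁ i j) _)))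
          (d-cancel _))))
        (solve 3 (λ x y w → x :+ (y :+ (w :- (x :+ y))) := w) refl
          (a * (T ⊗ T) i j) (b * (S ⊗ S) i j) (A₂ i j))

      represent : ∀ i j →
        a * (T ⊗ T) i j + (b * (S ⊗ S) i j + d * (G₁ i j + residue i j)) ≈ A₂ i j
      represent zero    (suc j) = fill zero (suc j) (residue-0j j)
      represent (suc i) zero    = fill (suc i) zero (residue-i0 i)
      represent zero    zero    = begin
        a * (T ⊗ T) 0F 0F + (b * (S ⊗ S) 0F 0F + d * (G₁ 0F 0F + residue 0F 0F))
          ≈⟨ +-cong (*-congˡ T²-corner) (+-cong (*-congˡ S²-corner) (*-congˡ (+-congˡ residue-00))) ⟩
        a * ((1# + t₀) * (1# + t₀) + t₀) + (b * ((1# + 1#) - x) + d * (G₁ 0F 0F + ((p + p) + 1#)))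
          ≈⟨ solve 7 (λ a b d t x g p →
               a :* ((⟨1⟩ :+ t) :* (⟨1⟩ :+ t) :+ t)
                 :+ (b :* ((⟨1⟩ :+ ⟨1⟩) :- x) :+ d :* (g :+ ((p :+ p) :+ ⟨1⟩)))
               := (((a :+ (a :* t :+ a :* t)) :+ a :* (t :+ t :* t)) :+ ((b :+ b) :+ d))
                    :+ ((d :* g :- b :* x) :+ (d :* p :+ d :* p))) refl
               a b d t₀ x (G₁ 0F 0F) p ⟩
        (((a + (a * t₀ + a * t₀)) + a * (t₀ + t₀ * t₀)) + ((b + b) + d))
          + ((d * G₁ 0F 0F - b * x) + (d * p + d * p))
          ≈⟨ +-cong (+-congʳ (+-congˡ (*-congˡ (sym (proj₂ (triangular t₀))))))
               (+-cong (+-cong (d-cancel _) (-‿cong (b-cancel _)))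
                 (+-cong (d-cancel _) (d-cancel _))) ⟩
        (((a + (a * t₀ + a * t₀)) + a * (y + y)) + ((b + b) + d))
          + ((A₁ 0F 0F - ((a + d) - (A₂ 0F 0F - A₁ 0F 0F)))
              + (- ((a * t₀ + a * y) + b) + - ((a * t₀ + a * y) + b)))
          ≈⟨ solve 7 (λ a b d t y w₁ w₂ →
               (((a :+ (a :* t :+ a :* t)) :+ a :* (y :+ y)) :+ ((b :+ b) :+ d))
                 :+ ((w₁ :- ((a :+ d) :- (w₂ :- w₁)))
                     :+ (:- ((a :* t :+ a :* y) :+ b) :+ :- ((a :* t :+ a :* y) :+ b)))
               := w₂) refl a b d t₀ y (A₁ 0F 0F) (A₂ 0F 0F) ⟩
        A₂ 0F 0F ∎
        where
        t₀ = t zero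
      represent (suc i) (suc j) = begin
        a * (T ⊗ T) (suc i) (suc j) + (b * (S ⊗ S) (suc i) (suc j)
          + d * (G₁ (suc i) (suc j) + residue (suc i) (suc j)))
          ≈⟨ +-cong (*-congˡ (T²-inner i j)) (+-cong (*-congˡ (S²-inner i j))
               (*-congˡ (+-congˡ (residue-ij i j)))) ⟩
        a * (δ + e i * t j) + (b * (δ + e i * (x * e j))
          + d * (G₁ (suc i) (suc j) + ((G₂ i j - G₁ (suc i) (suc j)) - e i * ρ j)))
          ≈⟨ solve 8 (λ a δ ei tj b xe d g₁₂ →
               a :* (δ :+ ei :* tj) :+ (b :* (δ :+ ei :* xe) :+ d :* g₁₂)
               := ((a :* δ :+ b :* δ) :+ ei :* (b :* xe)) :+ (ei :* (a :* tj) :+ d :* g₁₂))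
               refl a δ (e i) (t j) b (x * e j) d
               (G₁ (suc i) (suc j) + ((G₂ i j - G₁ (suc i) (suc j)) - e i * ρ j)) ⟩
        ((a * δ + b * δ) + e i * (b * (x * e j))) + (e i * (a * t j)
          + d * (G₁ (suc i) (suc j) + ((G₂ i j - G₁ (suc i) (suc j)) - e i * ρ j)))
          ≈⟨ +-congˡ (+-cong (*-congˡ (a-cancel _))
               (solve 5 (λ d g₁ g₂ ei ρ → d :* (g₁ :+ ((g₂ :- g₁) :- ei :* ρ))
                  := d :* g₂ :- ei :* (d :* ρ)) refl d (G₁ (suc i) (suc j)) (G₂ i j) (e i) (ρ j))) ⟩
        ((a * δ + b * δ) + e i * (b * (x * e j)))
          + (e i * (d * ρ j - b * (x * e j)) + (d * G₂ i j - e i * (d * ρ j)))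
          ≈⟨ +-congˡ (+-congˡ (+-congʳ (d-cancel _))) ⟩
        ((a * δ + b * δ) + e i * (b * (x * e j)))
          + (e i * (d * ρ j - b * (x * e j))
              + ((A₂ (suc i) (suc j) - (a * δ + b * δ)) - e i * (d * ρ j)))
          ≈⟨ solve 5 (λ δ ei bx dρ w → (δ :+ ei :* bx) :+ (ei :* (dρ :- bx) :+ ((w :- δ) :- ei :* dρ))
               := w) refl (a * δ + b * δ) (e i) (b * (x * e j)) (d * ρ j) (A₂ (suc i) (suc j)) ⟩
        A₂ (suc i) (suc j) ∎
        where
        δ = 𝟏 i j

      corner₂ : ∀ i j → a * (T ⊗ T) i j + (b * (S ⊗ S) i j
                  + d * ((Q′ ⊗ 𝟏) i j + (P′ ⊗ P′) i j)) ≈ A₂ i j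
      corner₂ i j = trans (+-congˡ (+-congˡ (*-congˡ (reduce i j)))) (represent i j)

  -- An injection of `Fin 3` into itself reaches every index, so all three coefficients are units.
  three-units-universal : (∀ x → ∃[ y ] y + y ≈ x + x * x) → ∀ n → 3 ≤ n →
    (α : Vector Carrier 3) → AtLeastThreeUnits α → Universal n α
  three-units-universal triangular n 3≤n α (ι , units) with halves n 3≤n
  ... | inj₁ (m , ≡.refl) = odd-representation triangular α every-unit
    where
    every-unit : ∀ i → Unit (α i)
    every-unit i with injective⇒surjective (Injection.injective ι) i
    ... | j , ≡.refl = units j
  ... | inj₂ (m , ≡.refl) = even-representation triangular α every-unit
    where
    every-unit : ∀ i → Unit (α i)
    every-unit i with injective⇒surjective (Injection.injective ι) i
    ... | j , ≡.refl = units j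

-- Halving x + x² in the integers and in the p-adic integers.

-- The witness is the triangular number z (z + 1) / 2, computed by the parity of `z`.
triangleℤ : ∀ z → ∃[ t ] t ℤ.+ t ≡ z ℤ.+ z ℤ.* z
triangleℤ z = lemma (z ℤ.%ℕ 2) (z ℤ./ℕ 2) (ℤ.n%ℕd<d z 2) (ℤ.a≡a%ℕn+[a/ℕn]*n z 2)
  where
  even : ∀ q → (q ℤ.+ (q ℤ.+ q) ℤ.* q) ℤ.+ (q ℤ.+ (q ℤ.+ q) ℤ.* q) ≡
               (0ℤ ℤ.+ q ℤ.* + 2) ℤ.+ (0ℤ ℤ.+ q ℤ.* + 2) ℤ.* (0ℤ ℤ.+ q ℤ.* + 2)
  even = solve-∀
  odd : ∀ q → (1ℤ ℤ.+ q) ℤ.* (1ℤ ℤ.+ (q ℤ.+ q)) ℤ.+ (1ℤ ℤ.+ q) ℤ.* (1ℤ ℤ.+ (q ℤ.+ q)) ≡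
              (1ℤ ℤ.+ q ℤ.* + 2) ℤ.+ (1ℤ ℤ.+ q ℤ.* + 2) ℤ.* (1ℤ ℤ.+ q ℤ.* + 2)
  odd = solve-∀
  lemma : ∀ r q → r ℕ.< 2 → z ≡ + r ℤ.+ q ℤ.* + 2 → ∃[ t ] t ℤ.+ t ≡ z ℤ.+ z ℤ.* z
  lemma 0 q _ ≡.refl = q ℤ.+ (q ℤ.+ q) ℤ.* q , even q
  lemma 1 q _ ≡.refl = (1ℤ ℤ.+ q) ℤ.* (1ℤ ℤ.+ (q ℤ.+ q)) , odd q
  lemma (suc (suc _)) q (s≤s (s≤s ())) _

-- Giving up one power of `p` makes one condition serve both cases: for 2 a digit is really lost,
-- for odd `p` the number 2 is invertible modulo every power.
Halvable : ℕ → Set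
Halvable p = ∀ k z → (+ p) ℤ.^ suc k ℤ.∣ z ℤ.+ z → (+ p) ℤ.^ k ℤ.∣ z

two-halvable : Halvable 2
two-halvable k z (ℤ.divides q eq) = ℤ.divides q
  (ℤ.*-cancelˡ-≡ (+ 2) z (q ℤ.* (+ 2) ℤ.^ k) (≡.trans (double z) (≡.trans eq (rearrange q ((+ 2) ℤ.^ k)))))
  where
  double : ∀ z → + 2 ℤ.* z ≡ z ℤ.+ z
  double = solve-∀
  rearrange : ∀ q m → q ℤ.* (+ 2 ℤ.* m) ≡ + 2 ℤ.* (q ℤ.* m)
  rearrange = solve-∀

odd-power : ∀ {p} w → p ≡ 1ℤ ℤ.+ (w ℤ.+ w) → ∀ k → ∃[ u ] p ℤ.^ k ≡ 1ℤ ℤ.+ (u ℤ.+ u)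
odd-power w eq zero    = 0ℤ , ≡.refl
odd-power w eq (suc k) with odd-power w eq k
... | u , eq′ = w ℤ.+ u ℤ.+ (w ℤ.* u ℤ.+ w ℤ.* u) , ≡.trans (≡.cong₂ ℤ._*_ eq eq′) (product w u)
  where
  product : ∀ w u → (1ℤ ℤ.+ (w ℤ.+ w)) ℤ.* (1ℤ ℤ.+ (u ℤ.+ u)) ≡
    1ℤ ℤ.+ ((w ℤ.+ u ℤ.+ (w ℤ.* u ℤ.+ w ℤ.* u)) ℤ.+ (w ℤ.+ u ℤ.+ (w ℤ.* u ℤ.+ w ℤ.* u)))
  product = solve-∀

-- If pᵏ = 1 + 2u, then z = z pᵏ - u (z + z), and pᵏ divides both terms.
odd-halvable : ∀ p → ¬ 2 ∣ p → Halvable p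
odd-halvable p 2∤p k z p^[1+k]∣z+z = ≡.subst ((+ p) ℤ.^ k ℤ.∣_) (≡.sym z≡)
  (ℤ.∣m∣n⇒∣m-n (ℤ.∣n⇒∣m*n z ℤ.∣-refl) (ℤ.∣n⇒∣m*n u p^k∣z+z))
  where
  1+2w : ∃[ w ] + p ≡ 1ℤ ℤ.+ (w ℤ.+ w)
  1+2w with p % 2 in eq | m%n<n p 2 | m≡m%n+[m/n]*n p 2
  ... | 0 | _ | _ = contradiction (m%n≡0⇒n∣m p 2 eq) 2∤p
  ... | 1 | _ | p≡ = + (p / 2) , ≡.cong +_ (≡.trans p≡ (≡.cong suc (≡.trans (ℕ.*-comm (p / 2) 2)
                        (≡.cong (p / 2 ℕ.+_) (ℕ.+-identityʳ (p / 2))))))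
  ... | suc (suc _) | s≤s (s≤s ()) | _

  u = proj₁ (odd-power (proj₁ 1+2w) (proj₂ 1+2w) k)

  p^k∣z+z : (+ p) ℤ.^ k ℤ.∣ z ℤ.+ z
  p^k∣z+z = ℤ.∣-trans (ℤ.∣n⇒∣m*n (+ p) ℤ.∣-refl) p^[1+k]∣z+z

  identity : ∀ z u → z ≡ z ℤ.* (1ℤ ℤ.+ (u ℤ.+ u)) ℤ.- u ℤ.* (z ℤ.+ z)
  identity = solve-∀

  z≡ : z ≡ z ℤ.* (+ p) ℤ.^ k ℤ.- u ℤ.* (z ℤ.+ z)
  z≡ = ≡.trans (identity z u) (≡.cong (λ m → z ℤ.* m ℤ.- u ℤ.* (z ℤ.+ z))
         (≡.sym (proj₂ (odd-power (proj₁ 1+2w) (proj₂ 1+2w) k))))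

module _ (p : ℕ) (halvable : Halvable p) where

  open CommutativeRing (ℤₚ p) using (_+_; _*_; _≈_)

  -- For p = 2, halving loses one digit of precision; hence the k-th
  -- approximation is taken from the (k + 1)-st one of x.
  triangleₚ : ∀ x → ∃[ y ] y + y ≈ x + x * x
  triangleₚ x = record { approx = λ k → t (suc k) ; coherent = coherent-t } , mk≈ₚ agrees
    where
    t : ℕ → ℤ
    t k = proj₁ (triangleℤ (approx x k))

    2t : ∀ k → t k ℤ.+ t k ≡ approx x k ℤ.+ approx x k ℤ.* approx x k
    2t k = proj₂ (triangleℤ (approx x k))

    -- Twice the difference is a difference of approximations of x + x², divisible by the power
    -- `suc k` of `p`; halving leaves the power `k`.
    coherent-t : ∀ k → t (suc (suc k)) ≡ t (suc k) [mod (+ p) ℤ.^ k ]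
    coherent-t k = mk-mod (halvable k _
      (≡.subst ((+ p) ℤ.^ suc k ℤ.∣_) double
        (_≡_[mod_].divides-difference
          (mod-+ (coherent x (suc k)) (mod-* (coherent x (suc k)) (coherent x (suc k)))))))
      where
      swap : ∀ s t → (s ℤ.+ s) ℤ.- (t ℤ.+ t) ≡ (s ℤ.- t) ℤ.+ (s ℤ.- t)
      swap = solve-∀
      double = ≡.trans (≡.cong₂ ℤ._-_ (≡.sym (2t (suc (suc k)))) (≡.sym (2t (suc k))))
        (swap (t (suc (suc k))) (t (suc k)))

    agrees : ∀ k → t (suc k) ℤ.+ t (suc k) ≡ approx x k ℤ.+ approx x k ℤ.* approx x k
                     [mod (+ p) ℤ.^ k ]
    agrees k = mod-trans (mod-reflexive (2t (suc k)))
      (mod-+ (coherent x k) (mod-* (coherent x k) (coherent x k)))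

-- The value of f.

-- The lower bound is the first component of `Admissible`, so it suffices that 3 is admissible.
f≡3 : ∀ p → Halvable p → ∀ n → 3 ≤ n → f[ p , n ]≡ 3
f≡3 p halvable n 3≤n =
  (ℕ.≤-refl , MatrixForms.three-units-universal (ℤₚ p) (triangleₚ p halvable) n 3≤n) , λ _ → proj₁

theorem3p2 : (p : ℕ) → Prime p → (n : ℕ) → 4 ≤ n →
    (¬ (2 ∣ p) → f[ p , n ]≤ 3) × (p ≡ 2 → f[ p , n ]≤ 4)
theorem3p2 p _ n 4≤n =
    (λ 2∤p → 3 , f≡3 p (odd-halvable p 2∤p) n 3≤n , ℕ.≤-refl)
  , (λ { ≡.refl → 3 , f≡3 2 two-halvable n 3≤n , ℕ.n≤1+n 3 })
  where
  3≤n = ℕ.≤-trans (ℕ.n≤1+n 3) 4≤n
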